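{- Let $n$ be even, let $r\le s\le 2r-1$, and let $m=s-r+1$. Then $$\nu(n,P^{(r)}_s)\ge 2h(n,r,m)+h(n,r-1,m).$$
   Context: $K^{(r)}_n$ denotes the ordered complete $r$-uniform hypergraph on vertex set $[n]=\{1,\dots,n\}$ (natural order), whose edges are all $r$-subsets of $[n]$. A copy of an ordered hypergraph $H$ in $K^{(r)}_n$ is the image of $H$ under an order-preserving injection $V(H)\to[n]$. The natural (tight) path $P^{(r)}_s$ has vertices $v_1<\dots<v_s$ and its edges are all sets of $r$ consecutive vertices $\{v_j,\dots,v_{j+r-1}\}$, $1\le j\le s-r+1$. For an ordered $r$-uniform $H$, $\nu(n,H)$ is the maximum number of copies of $H$ in $K^{(r)}_n$ that are pairwise edge-disjoint. An interval partition $(X,Y,Z)$ of $[n]$ consists of consecutive (possibly empty) intervals $X<Y<Z$ with union $[n]$. A set $S\subseteq[n]$ is $m$-left-biased if there is an interval partition $(X,Y,Z)$ of $[n]$ with $|X|=|Z|$, $|X\cap S|=m$ and $|Z\cap S|=0$. $h(n,t,m)$ denotes the number of $t$-subsets of $[n]$ that are $m$-left-biased. -}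

module Defs where

open import Data.Bool using (false; _∧_)
import Data.Bool.Properties as Bool
open import Data.Fin using (Fin; zero; suc; toℕ; fromℕ<)
import Data.Fin as Fin
import Data.Fin.Properties as Fin
open import Data.Fin.Subset using (Subset; inside; outside; ∣_∣; _∩_; ⊤)
open import Data.Fin.Subset.Properties using (_∈?_)
open import Data.List using (List; []; _∷_; _++_; map; length; filter; upTo; allFin; cartesianProductWith; lookup)
open import Data.List.Membership.Propositional using (_∈_; find; lose)
open import Data.List.Membership.Propositional.Properties using (∈-allFin; ∈-cartesianProductWith⁺; ∈-cartesianProductWith⁻; ∈-map⁺; ∈-map⁻; ∈-filter⁺; ∈-filter⁻; ∈-upTo⁻; ∈-lookup)
open import Data.List.Properties using (map-cong)
open import Data.List.Relation.Binary.Disjoint.Propositional using (Disjoint)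
import Data.List.Relation.Binary.Disjoint.DecPropositional as DisjointDec
import Data.List.Properties as List
open import Data.List.Relation.Unary.All using (All; []; _∷_)
import Data.List.Relation.Unary.All as All
open import Data.List.Relation.Unary.AllPairs using (AllPairs; []; _∷_; allPairs?)
open import Data.List.Relation.Unary.Any using (Any; here; index; any?)
open import Data.List.Relation.Unary.Any.Properties using (lookup-index)
open import Data.List.Relation.Unary.Unique.Propositional using (Unique)
open import Data.Nat using (ℕ; zero; suc; _+_; _∸_; _≤_; _<_; z≤n; s≤s; _≤?_; _<?_; _≟_)
open import Data.Nat.Properties using (≤-trans; m+n∸m≡n; m≤n⇒m<n∨m≡n; +-identityʳ; +-suc; ≤-pred)
open import Data.Product using (Σ; ∃; ∃₂; _×_; _,_; proj₁; proj₂)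
import Data.Product.Properties as Product
open import Data.Sum using (inj₁; inj₂)
open import Data.Vec using (Vec; []; _∷_; tabulate)
import Data.Vec as Vec
import Data.Vec.Properties as Vec
open import Function using (_∘_)
open import Function.Bundles using (mk⇔)
open import Relation.Binary using (DecidableEquality)
open import Relation.Binary.PropositionalEquality using (_≡_; _≗_; refl; sym; trans; cong; cong₂; subst)
open import Relation.Nullary using (¬_; Dec; yes; no; does; contradiction)
open import Relation.Nullary.Decidable using (map′; _×-dec_; _→-dec_; ¬?; does-⇔)
open import Relation.Unary using (Decidable)

-- The vertex set [n] is Fin n, so vertex i of [n] is the element with toℕ = i - 1.

interval : ∀ {n} → ℕ → ℕ → Subset n
interval a b = tabulate λ i → does (a ≤? toℕ i) ∧ does (toℕ i <? b)

private
  tabulate-false : ∀ n → ∣ tabulate {n = n} (λ _ → false) ∣ ≡ 0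
  tabulate-false zero    = refl
  tabulate-false (suc n) = tabulate-false n

  m<n∸o⇒m+o<n : ∀ m n o → m < n ∸ o → m + o < n
  m<n∸o⇒m+o<n m n       zero    m< = subst (_< n) (sym (+-identityʳ m)) m<
  m<n∸o⇒m+o<n m (suc n) (suc o) m< = subst (_< suc n) (sym (+-suc m o)) (s≤s (m<n∸o⇒m+o<n m n o m<))

∣interval∣ : ∀ {n} a b → b ≤ n → ∣ interval {n} a b ∣ ≡ b ∸ a
∣interval∣ {zero}  zero    zero    _         = refl
∣interval∣ {zero}  (suc a) zero    _         = refl
∣interval∣ {suc n} zero    zero    _         = ∣interval∣ {n} zero zero z≤n
∣interval∣ {suc n} (suc a) zero    _         =
  trans (cong ∣_∣ (Vec.tabulate-cong {n = n} λ i → Bool.∧-zeroʳ (does (suc a ≤? suc (toℕ i)))))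
        (tabulate-false n)
∣interval∣ {suc n} zero    (suc b) (s≤s b≤n) = cong suc (∣interval∣ {n} zero b b≤n)
∣interval∣ {suc n} (suc a) (suc b) (s≤s b≤n) =
  trans (cong ∣_∣ (Vec.tabulate-cong {n = n} λ i → cong (_∧ does (toℕ i <? b))
          (does-⇔ (mk⇔ ≤-pred s≤s) (suc a ≤? suc (toℕ i)) (a ≤? toℕ i))))
        (∣interval∣ {n} a b b≤n)

-- Vertices are ordered as Fin order; the edge set is given by an
-- enumeration.
record OrderedHypergraph (r : ℕ) : Set where
  field
    order   : ℕ
    edges   : List (Subset order)
    uniform : All (λ e → ∣ e ∣ ≡ r) edges

open OrderedHypergraph public

-- The natural tight path on s vertices. There are no edges when s < r.
path : ∀ r s → OrderedHypergraph r
path r s = record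
  { order   = s
  ; edges   = map edge (upTo (suc s ∸ r))
  ; uniform = All.tabulate λ e∈ → uniform′ (∈-map⁻ edge e∈)
  }
  where
  edge : ℕ → Subset s
  edge j = interval j (j + r)

  uniform′ : ∀ {e} → (∃ λ j → j ∈ upTo (suc s ∸ r) × e ≡ edge j) → ∣ e ∣ ≡ r
  uniform′ (j , j∈ , refl) =
    trans (∣interval∣ j (j + r) (≤-pred (m<n∸o⇒m+o<n j (suc s) r (∈-upTo⁻ j∈))))
          (m+n∸m≡n j r)

image : ∀ {k n} → (Fin k → Fin n) → Subset k → Subset n
image f S = tabulate λ y → does (Fin.any? λ x → (x ∈? S) ×-dec (f x Fin.≟ y))

-- A subhypergraph of the complete hypergraph on [n]: vertex set, and
-- enumerated edge set.
SubHypergraph : ℕ → Set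
SubHypergraph n = Subset n × List (Subset n)

edgesOf : ∀ {n} → SubHypergraph n → List (Subset n)
edgesOf = proj₂

-- Strictly increasing, i.e. an order-preserving injection.
OrderEmbedding : ∀ {k n} → (Fin k → Fin n) → Set
OrderEmbedding f = ∀ i j → i Fin.< j → f i Fin.< f j

copyUnder : ∀ {r n} (H : OrderedHypergraph r) → (Fin (order H) → Fin n) → SubHypergraph n
copyUnder H f = image f ⊤ , map (image f) (edges H)

-- An order embedding maps r-sets to r-sets, so a copy automatically lies in
-- the complete r-uniform hypergraph on [n]. It is determined by its vertex
-- set, so _≡_ on copies is equality of hypergraphs, even though the edge sets
-- are presented as lists.
IsCopy : ∀ {r n} → OrderedHypergraph r → SubHypergraph n → Set
IsCopy {n = n} H c = Σ (Fin (order H) → Fin n) λ f → OrderEmbedding f × c ≡ copyUnder H f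

EdgeDisjoint : ∀ {n} → SubHypergraph n → SubHypergraph n → Set
EdgeDisjoint c d = Disjoint (edgesOf c) (edgesOf d)

-- A set of pairwise edge-disjoint copies of H, as a duplicate-free list.
record IsPacking {r n} (H : OrderedHypergraph r) (cs : List (SubHypergraph n)) : Set where
  field
    copies   : All (IsCopy H) cs
    distinct : Unique cs
    disjoint : AllPairs EdgeDisjoint cs

HasPacking : ∀ {r} → ℕ → OrderedHypergraph r → ℕ → Set
HasPacking n H k = Σ (List (SubHypergraph n)) λ cs → IsPacking H cs × length cs ≡ k

IsPackingNumber : ∀ {r} → ℕ → OrderedHypergraph r → ℕ → Set
IsPackingNumber n H k = HasPacking n H k × (∀ l → HasPacking n H l → l ≤ k)

private
  image-cong : ∀ {k n} {f g : Fin k → Fin n} → f ≗ g → image f ≗ image g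
  image-cong {f = f} {g} f≗g S = Vec.tabulate-cong λ y → does-⇔
    (mk⇔ (λ (x , x∈S , eq) → x , x∈S , trans (sym (f≗g x)) eq)
         (λ (x , x∈S , eq) → x , x∈S , trans (f≗g x) eq))
    (Fin.any? λ x → (x ∈? S) ×-dec (f x Fin.≟ y))
    (Fin.any? λ x → (x ∈? S) ×-dec (g x Fin.≟ y))

  vecs : ∀ {A : Set} → List A → ∀ k → List (Vec A k)
  vecs xs zero    = [] ∷ []
  vecs xs (suc k) = cartesianProductWith _∷_ xs (vecs xs k)

  ∈-vecs : ∀ {A : Set} {xs : List A} → (∀ x → x ∈ xs) → ∀ {k} (v : Vec A k) → v ∈ vecs xs k
  ∈-vecs all []      = here refl
  ∈-vecs all (x ∷ v) = ∈-cartesianProductWith⁺ _∷_ (all x) (∈-vecs all v)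

  lists : ∀ {A : Set} → List A → ℕ → List (List A)
  lists xs zero    = [] ∷ []
  lists xs (suc k) = cartesianProductWith _∷_ xs (lists xs k)

  ∈-lists⁺ : ∀ {A : Set} {xs ys : List A} → All (_∈ xs) ys → ys ∈ lists xs (length ys)
  ∈-lists⁺ []         = here refl
  ∈-lists⁺ (y∈ ∷ ys∈) = ∈-cartesianProductWith⁺ _∷_ y∈ (∈-lists⁺ ys∈)

  ∈-lists⁻ : ∀ {A : Set} (xs : List A) k {ys} → ys ∈ lists xs k → All (_∈ xs) ys × length ys ≡ k
  ∈-lists⁻ xs zero    (here refl) = [] , refl
  ∈-lists⁻ xs (suc k) ys∈ with ∈-cartesianProductWith⁻ _∷_ xs (lists xs k) ys∈
  ... | y , zs , y∈ , zs∈ , refl with ∈-lists⁻ xs k zs∈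
  ...   | zs⊆ , len = y∈ ∷ zs⊆ , cong suc len

  unique-lookup : ∀ {A : Set} {xs : List A} → Unique xs →
                  ∀ i j → lookup xs i ≡ lookup xs j → i ≡ j
  unique-lookup (_  ∷ _) zero    zero    _  = refl
  unique-lookup {xs = _ ∷ xs} (x∉ ∷ _) zero (suc j) eq =
    contradiction eq (All.lookup x∉ (∈-lookup {xs = xs} j))
  unique-lookup {xs = _ ∷ xs} (x∉ ∷ _) (suc i) zero eq =
    contradiction (sym eq) (All.lookup x∉ (∈-lookup {xs = xs} i))
  unique-lookup (_  ∷ u) (suc i) (suc j) eq = cong suc (unique-lookup u i j eq)

  unique-length : ∀ {A : Set} {xs ys : List A} → Unique ys → All (_∈ xs) ys → length ys ≤ length xs
  unique-length {xs = xs} {ys} u ys⊆ = Fin.injective⇒≤ {f = f} λ {i} {j} eq →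
    unique-lookup u i j
      (trans (lookup-index (mem i)) (trans (cong (lookup xs) eq) (sym (lookup-index (mem j)))))
    where
    mem : ∀ i → lookup ys i ∈ xs
    mem i = All.lookup ys⊆ (∈-lookup {xs = ys} i)
    f : Fin (length ys) → Fin (length xs)
    f i = index (mem i)

  greatest : ∀ {P : ℕ → Set} → Decidable P → P 0 → ∀ N → (∀ l → P l → l ≤ N) →
             ∃ λ k → P k × (∀ l → P l → l ≤ k)
  greatest P? p0 zero    ub = 0 , p0 , ub
  greatest {P} P? p0 (suc N) ub with P? (suc N)
  ... | yes p = suc N , p , ub
  ... | no ¬p = greatest P? p0 N ub′
    where
    ub′ : ∀ l → P l → l ≤ N
    ub′ l pl with m≤n⇒m<n∨m≡n (ub l pl)
    ... | inj₁ l<    = ≤-pred l<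
    ... | inj₂ refl  = contradiction pl ¬p

  _≟ˢ_ : ∀ {n} → DecidableEquality (Subset n)
  _≟ˢ_ = Vec.≡-dec Bool._≟_

  _≟ᶜ_ : ∀ {n} → DecidableEquality (SubHypergraph n)
  _≟ᶜ_ = Product.≡-dec _≟ˢ_ (List.≡-dec _≟ˢ_)

  orderEmbedding? : ∀ {k n} → Decidable (OrderEmbedding {k} {n})
  orderEmbedding? f = Fin.all? λ i → Fin.all? λ j → (i Fin.<? j) →-dec (f i Fin.<? f j)

  module _ {r : ℕ} (n : ℕ) (H : OrderedHypergraph r) where

    embeddings : List (Vec (Fin n) (order H))
    embeddings = filter (orderEmbedding? ∘ Vec.lookup) (vecs (allFin n) (order H))

    allCopies : List (SubHypergraph n)
    allCopies = map (copyUnder H ∘ Vec.lookup) embeddings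

    allCopies-sound : ∀ {c} → c ∈ allCopies → IsCopy H c
    allCopies-sound c∈ with ∈-map⁻ (copyUnder H ∘ Vec.lookup) c∈
    ... | v , v∈ , eq =
      Vec.lookup v , proj₂ (∈-filter⁻ (orderEmbedding? ∘ Vec.lookup) {xs = vecs (allFin n) (order H)} v∈) , eq

    allCopies-complete : ∀ {c} → IsCopy H c → c ∈ allCopies
    allCopies-complete (f , emb , refl) = subst (_∈ allCopies) eq
      (∈-map⁺ (copyUnder H ∘ Vec.lookup)
        (∈-filter⁺ (orderEmbedding? ∘ Vec.lookup) (∈-vecs ∈-allFin v) emb′))
      where
      v : Vec (Fin n) (order H)
      v = tabulate f
      v≗f : Vec.lookup v ≗ f
      v≗f = Vec.lookup∘tabulate f
      emb′ : OrderEmbedding (Vec.lookup v)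
      emb′ i j i<j rewrite v≗f i | v≗f j = emb i j i<j
      eq : copyUnder H (Vec.lookup v) ≡ copyUnder H f
      eq = cong₂ _,_ (image-cong v≗f ⊤) (map-cong (image-cong v≗f) (edges H))

    hasPacking? : Decidable (HasPacking n H)
    hasPacking? k = map′ to from (any? good? (lists allCopies k))
      where
      Good : List (SubHypergraph n) → Set
      Good cs = Unique cs × AllPairs EdgeDisjoint cs
      good? : Decidable Good
      good? cs = allPairs? (λ c d → ¬? (c ≟ᶜ d)) cs
           ×-dec allPairs? (λ c d → DisjointDec.disjoint? _≟ˢ_ (edgesOf c) (edgesOf d)) cs
      to : Any Good (lists allCopies k) → HasPacking n H k
      to p with find p
      ... | cs , cs∈ , u , d with ∈-lists⁻ allCopies k cs∈
      ...   | cs⊆ , len = cs , record { copies = All.map allCopies-sound cs⊆ ; distinct = u ; disjoint = d } , len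
      from : HasPacking n H k → Any Good (lists allCopies k)
      from (cs , p , refl) =
        lose (∈-lists⁺ (All.map allCopies-complete (IsPacking.copies p)))
             (IsPacking.distinct p , IsPacking.disjoint p)

packingNumber : ∀ {r} n (H : OrderedHypergraph r) → ∃ (IsPackingNumber n H)
packingNumber n H = greatest (hasPacking? n H)
  ([] , record { copies = [] ; distinct = [] ; disjoint = [] } , refl)
  (length (allCopies n H))
  λ { l (cs , p , refl) →
      unique-length (IsPacking.distinct p) (All.map (allCopies-complete n H) (IsPacking.copies p)) }

ν : ∀ {r} → ℕ → OrderedHypergraph r → ℕ
ν n H = proj₁ (packingNumber n H)

-- Consecutive intervals X < Y < Z with union [n], given by the two cut points.
record IntervalPartition (n : ℕ) : Set where
  constructor cut
  field
    a b : ℕ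
    a≤b : a ≤ b
    b≤n : b ≤ n

  X Y Z : Subset n
  X = interval 0 a
  Y = interval a b
  Z = interval b n

LeftBiased : ∀ {n} → ℕ → Subset n → Set
LeftBiased {n} m S = Σ (IntervalPartition n) λ π → let open IntervalPartition π in
  ∣ X ∣ ≡ ∣ Z ∣ × ∣ X ∩ S ∣ ≡ m × ∣ Z ∩ S ∣ ≡ 0

leftBiased? : ∀ {n} m → Decidable (LeftBiased {n} m)
leftBiased? {n} m S = map′ to from (Fin.any? λ a → Fin.any? λ b → (toℕ a ≤? toℕ b) ×-dec biased? (toℕ a) (toℕ b))
  where
  Biased : ℕ → ℕ → Set
  Biased a b = ∣ interval {n} 0 a ∣ ≡ ∣ interval {n} b n ∣
             × ∣ interval 0 a ∩ S ∣ ≡ m × ∣ interval b n ∩ S ∣ ≡ 0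
  biased? : ∀ a b → Dec (Biased a b)
  biased? a b = (_ ≟ _) ×-dec (_ ≟ _) ×-dec (_ ≟ _)
  to : (∃₂ λ (a b : Fin (suc n)) → toℕ a ≤ toℕ b × Biased (toℕ a) (toℕ b)) → LeftBiased m S
  to (a , b , a≤b , p) = cut (toℕ a) (toℕ b) a≤b (≤-pred (Fin.toℕ<n b)) , p
  from : LeftBiased m S → ∃₂ λ (a b : Fin (suc n)) → toℕ a ≤ toℕ b × Biased (toℕ a) (toℕ b)
  from (cut a b a≤b b≤n , p) = fromℕ< a< , fromℕ< b< , q
    where
    a< : a < suc n
    a< = s≤s (≤-trans a≤b b≤n)
    b< : b < suc n
    b< = s≤s b≤n
    q : toℕ (fromℕ< a<) ≤ toℕ (fromℕ< b<) × Biased (toℕ (fromℕ< a<)) (toℕ (fromℕ< b<))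
    q rewrite Fin.toℕ-fromℕ< a< | Fin.toℕ-fromℕ< b< = a≤b , p

-- Every subset of [n], exactly once.
subsets : ∀ n → List (Subset n)
subsets zero    = [] ∷ []
subsets (suc n) = map (inside ∷_) (subsets n) ++ map (outside ∷_) (subsets n)

h : ℕ → ℕ → ℕ → ℕ
h n t m = length (filter (λ S → (∣ S ∣ ≟ t) ×-dec leftBiased? m S) (subsets n))

{-# OPTIONS --safe #-}
module Submission where

-- Vertices are 0, …, n - 1 and k = m - 1. Let S = {x₀ < x₁ < …} be m-left-biased
-- and b = x_k. If ∣ S ∣ = r, walk through S and then through the translates
-- x₀ + (n - b), …, x_{k-1} + (n - b); if ∣ S ∣ = r - 1, visit n - 1 - b in
-- between. Either way this is a path with m edges. Mirror images of the paths
-- of the r-sets give a third family.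
--
-- Every edge has exactly r - m + 1 vertices in [b, n - 1 - b], at least one of
-- them an end, so the edge determines b. The edge contains only the end b,
-- both ends, or only the end n - 1 - b, which tells the family. Finally, the
-- edge contains each of x₀, …, x_{k-1} or its translate, so it determines S.

open import Defs
open import Data.Empty using (⊥)
open import Data.Fin using (Fin; zero; suc; toℕ; fromℕ<)
import Data.Fin as Fin
open import Data.Fin.Properties using (toℕ-fromℕ<; toℕ<n; toℕ-injective; any?)
open import Data.Fin.Subset using (Subset; inside; outside; ∣_∣; _∩_; _∈_)
open import Data.Fin.Subset.Properties using (_∈?_; ⊆-antisym; x∈p⇒∣p-x∣<∣p∣; x∈p∩q⁺; ∣p∩q∣≤∣p∣; ∣p∩q∣≤∣q∣)
open import Data.List using (List; []; _∷_; _++_; map; length; filter)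
import Data.List.Membership.Propositional as List
open import Data.List.Membership.Propositional.Properties using (∈-map⁺; ∈-map⁻; ∈-upTo⁺; ∈-upTo⁻; ∈-++⁻)
open import Data.List.Properties using (length-map; length-++)
open import Data.List.Relation.Unary.All using (All; []; _∷_)
import Data.List.Relation.Unary.All as All
import Data.List.Relation.Unary.All.Properties as All
open import Data.List.Relation.Unary.AllPairs using (AllPairs; []; _∷_)
import Data.List.Relation.Unary.AllPairs as AllPairs
import Data.List.Relation.Unary.AllPairs.Properties as AllPairs
open import Data.List.Relation.Unary.Unique.Propositional using (Unique)
import Data.List.Relation.Unary.Unique.Propositional.Properties as Unique
open import Data.Nat using (ℕ; zero; suc; _+_; _*_; _∸_; _≤_; _<_; _≥_; z≤n; s≤s; _≤?_; _<?_; _≟_)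
open import Data.Nat.Divisibility using (_∣_)
open import Data.Nat.Properties
open import Data.Product using (∃; _×_; _,_; proj₁; proj₂)
open import Data.Sum using (_⊎_; inj₁; inj₂)
open import Data.Vec using ([]; _∷_; here; there; tabulate)
open import Data.Vec.Properties using (lookup⇒[]=; []=⇒lookup; lookup∘tabulate; ∷-injectiveʳ)
open import Function using (_∘_)
open import Relation.Binary.PropositionalEquality using (_≡_; _≢_; refl; sym; trans; cong; cong₂; subst; subst₂; module ≡-Reasoning)
open import Relation.Nullary using (yes; no; does; proof; Reflects; invert; contradiction)
open import Relation.Nullary.Decidable using (dec-true; _×-dec_)
open import Relation.Unary using (Decidable)

-- Membership in intervals and images.

∈-tabulate⁺ : ∀ {n} {P : Fin n → Set} (P? : Decidable P) {y} → P y → y ∈ tabulate (does ∘ P?)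
∈-tabulate⁺ P? {y} p = lookup⇒[]= y _ (trans (lookup∘tabulate _ y) (dec-true (P? y) p))

∈-tabulate⁻ : ∀ {n} {P : Fin n → Set} (P? : Decidable P) {y} → y ∈ tabulate (does ∘ P?) → P y
∈-tabulate⁻ P? {y} y∈ = invert
  (subst (Reflects _) (trans (sym (lookup∘tabulate _ y)) ([]=⇒lookup y∈)) (proof (P? y)))

∈-interval⁺ : ∀ {n} a b {y : Fin n} → a ≤ toℕ y → toℕ y < b → y ∈ interval a b
∈-interval⁺ a b a≤y y<b = ∈-tabulate⁺ (λ i → (a ≤? toℕ i) ×-dec (toℕ i <? b)) (a≤y , y<b)

∈-interval⁻ : ∀ {n} a b {y : Fin n} → y ∈ interval a b → a ≤ toℕ y × toℕ y < b
∈-interval⁻ a b = ∈-tabulate⁻ (λ i → (a ≤? toℕ i) ×-dec (toℕ i <? b))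

∈-image⁺ : ∀ {k n} (f : Fin k → Fin n) {S x} → x ∈ S → f x ∈ image f S
∈-image⁺ f {S} {x} x∈S =
  ∈-tabulate⁺ (λ y → any? λ x → (x ∈? S) ×-dec (f x Fin.≟ y)) (x , x∈S , refl)

∈-image⁻ : ∀ {k n} (f : Fin k → Fin n) {S y} → y ∈ image f S → ∃ λ x → x ∈ S × f x ≡ y
∈-image⁻ f {S} = ∈-tabulate⁻ λ y → any? λ x → (x ∈? S) ×-dec (f x Fin.≟ y)

-- Enumerating a subset in increasing order.

-- The i-th smallest element of S, counting from 0. The values for i ≥ ∣ S ∣
-- are junk, but chosen so that nth S is strictly increasing everywhere.
nth : ∀ {n} → Subset n → ℕ → ℕ
nth []            i       = i
nth (inside  ∷ S) zero    = 0
nth (inside  ∷ S) (suc i) = suc (nth S i)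
nth (outside ∷ S) i       = suc (nth S i)

nth-mono-< : ∀ {n} (S : Subset n) {i j} → i < j → nth S i < nth S j
nth-mono-< []            i<j                       = i<j
nth-mono-< (inside  ∷ S) {zero}  {suc j} i<j       = s≤s z≤n
nth-mono-< (inside  ∷ S) {suc i} {suc j} (s≤s i<j) = s≤s (nth-mono-< S i<j)
nth-mono-< (outside ∷ S) i<j                       = s≤s (nth-mono-< S i<j)

nth-∈ : ∀ {n} (S : Subset n) {i} → i < ∣ S ∣ → ∃ λ y → y ∈ S × toℕ y ≡ nth S i
nth-∈ (inside ∷ S) {zero} _ = zero , here , refl
nth-∈ (inside ∷ S) {suc i} (s≤s i<) with nth-∈ S i<
... | y , y∈S , eq = suc y , there y∈S , cong suc eq
nth-∈ (outside ∷ S) i< with nth-∈ S i<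
... | y , y∈S , eq = suc y , there y∈S , cong suc eq

∈⇒nth : ∀ {n} (S : Subset n) {y} → y ∈ S → ∃ λ i → i < ∣ S ∣ × nth S i ≡ toℕ y
∈⇒nth (inside ∷ S) here = 0 , s≤s z≤n , refl
∈⇒nth (inside ∷ S) (there y∈S) with ∈⇒nth S y∈S
... | i , i< , eq = suc i , s≤s i< , cong suc eq
∈⇒nth (outside ∷ S) (there y∈S) with ∈⇒nth S y∈S
... | i , i< , eq = i , i< , cong suc eq

nth-<-interval : ∀ {n} a (S : Subset n) {i} → i < ∣ interval 0 a ∩ S ∣ → nth S i < a
nth-<-interval {n} zero S i< =
  contradiction (≤-trans i< (≤-trans (∣p∩q∣≤∣p∣ (interval 0 0) S) (≤-reflexive (∣interval∣ {n} 0 0 z≤n)))) λ()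
nth-<-interval (suc a) (inside  ∷ S) {zero}  _        = s≤s z≤n
nth-<-interval (suc a) (inside  ∷ S) {suc i} (s≤s i<) = s≤s (nth-<-interval a S i<)
nth-<-interval (suc a) (outside ∷ S)         i<       = s≤s (nth-<-interval a S i<)

nth-⊆ : ∀ {n} (S T : Subset n) → (∀ {i} → i < ∣ S ∣ → ∃ λ j → j < ∣ T ∣ × nth T j ≡ nth S i) →
        ∀ {y} → y ∈ S → y ∈ T
nth-⊆ S T sub y∈S with ∈⇒nth S y∈S
... | i , i< , eq with sub i<
...   | j , j< , eq′ with nth-∈ T j<
...     | z , z∈T , eq″ = subst (_∈ T) (toℕ-injective (trans eq″ (trans eq′ eq))) z∈T

subsets-unique : ∀ n → Unique (subsets n)
subsets-unique zero    = [] ∷ []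
subsets-unique (suc n) =
  Unique.++⁺ (Unique.map⁺ ∷-injectiveʳ (subsets-unique n)) (Unique.map⁺ ∷-injectiveʳ (subsets-unique n)) apart
  where
  apart : ∀ {S} → S List.∈ map (inside ∷_) (subsets n) × S List.∈ map (outside ∷_) (subsets n) → ⊥
  apart (S∈i , S∈o) with ∈-map⁻ (inside ∷_) S∈i | ∈-map⁻ (outside ∷_) S∈o
  ... | _ , _ , refl | _ , _ , ()

-- Pairing the codes with validity proofs leaves the underlying list unchanged, so length and
-- uniqueness transfer to the list of pairs in `packing`.
map-proj₁-toList : ∀ {A : Set} {P : A → Set} {xs : List A} (ps : All P xs) → map proj₁ (All.toList ps) ≡ xs
map-proj₁-toList []       = refl
map-proj₁-toList (_ ∷ ps) = cong (_ ∷_) (map-proj₁-toList ps)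

-- The reflection of {0, ..., n - 1}, meaningful for `y < n`; `rev n` acts on vertices and `rev s`
-- on positions in a path.
rev : ℕ → ℕ → ℕ
rev n y = n ∸ suc y

rev-+ : ∀ {n y} → y < n → rev n y + suc y ≡ n
rev-+ = m∸n+n≡m

rev-< : ∀ {n y} → y < n → rev n y < n
rev-< {n} {y} y<n = ≤-trans (m<m+n (rev n y) (s≤s z≤n)) (≤-reflexive (rev-+ y<n))

rev-anti-< : ∀ {n y z} → y < z → z < n → rev n z < rev n y
rev-anti-< y<z z<n = ∸-monoʳ-< (s≤s y<z) z<n

rev-rev : ∀ {n y} → y < n → rev n (rev n y) ≡ y
rev-rev {n} {y} y<n = trans (cong (_∸ suc (rev n y)) (sym (trans (sym (+-suc _ y)) (rev-+ y<n))))
                            (m+n∸m≡n (suc (rev n y)) y)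

-- With `r = suc r′` and `s = r + k`, the path has `suc k` edges, starting at the positions `j ≤ k`.
module Paths (n r′ k : ℕ) where

  r s : ℕ
  r = suc r′
  s = r + k

  -- Edges and the central interval they meet.

  Edge : (ℕ → ℕ) → ℕ → ℕ → Set
  Edge F j y = ∃ λ i → j ≤ i × i < j + r × F i ≡ y

  -- F enumerates a path of which every edge meets the interval [b, n - 1 - b]
  -- in F k, …, F r′, and at least one of these hits an end of the interval.
  record Zoned (b : ℕ) (F : ℕ → ℕ) : Set where
    field
      mono  : ∀ {i j} → i < j → j < s → F i < F j
      bound : ∀ {i} → i < s → F i < n
      k≤r′  : k ≤ r′
      low   : ∀ {i} → i < k → F i < b
      b≤Fk  : b ≤ F k
      Fr′+b<n : F r′ + b < n
      high  : ∀ {i} → r ≤ i → i < s → n ≤ F i + b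
      end   : F k ≡ b ⊎ suc (F r′ + b) ≡ n

    mono-≤ : ∀ {i j} → i ≤ j → j < s → F i ≤ F j
    mono-≤ i≤j j<s with m≤n⇒m<n∨m≡n i≤j
    ... | inj₁ i<j  = <⇒≤ (mono i<j j<s)
    ... | inj₂ refl = ≤-refl

    cancel-< : ∀ {i j} → i < s → F i < F j → i < j
    cancel-< {i} {j} i<s Fi<Fj = ≰⇒> λ j≤i → <⇒≱ Fi<Fj (mono-≤ j≤i i<s)

  r′<s : r′ < s
  r′<s = s≤s (m≤m+n r′ k)

  index<s : ∀ {i j} → j ≤ k → i < j + r → i < s
  index<s j≤k i<j+r = ≤-trans i<j+r (≤-trans (+-monoˡ-≤ r j≤k) (≤-reflexive (+-comm k r)))

  -- By `low`, positions before `k` give vertices left of the interval; by `high`, positions from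
  -- `r` on give vertices right of it.
  middle-index : ∀ {b F j y} → Zoned b F → j ≤ k → Edge F j y → b ≤ y → y + b < n →
                 ∃ λ i → k ≤ i × i ≤ r′ × F i ≡ y
  middle-index Z j≤k (i , j≤i , i<j+r , refl) b≤y y+b<n =
      i , ≮⇒≥ (λ i<k → <⇒≱ (low i<k) b≤y)
    , ≮⇒≥ (λ r≤i → <⇒≱ y+b<n (high r≤i (index<s j≤k i<j+r)))
    , refl
    where open Zoned Z

  -- An edge starts at `j ≤ k` and ends at position `j + r′ ≥ r′`, so it contains the whole block of
  -- positions `k`, ..., `r′`.
  middle-edge : ∀ {F j i} → j ≤ k → k ≤ i → i ≤ r′ → Edge F j (F i)
  middle-edge {j = j} j≤k k≤i i≤r′ = _ , ≤-trans j≤k k≤i , ≤-trans (s≤s i≤r′) (m≤n+m r j) , refl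

  middle-bounds : ∀ {b F i} → Zoned b F → k ≤ i → i ≤ r′ → b ≤ F i × F i + b < n
  middle-bounds {b} Z k≤i i≤r′ =
      ≤-trans b≤Fk (mono-≤ k≤i (≤-<-trans i≤r′ r′<s))
    , ≤-<-trans (+-monoˡ-≤ b (mono-≤ i≤r′ r′<s)) Fr′+b<n
    where open Zoned Z

  -- Recovering the central interval and its extreme vertices from an edge.

  -- If b < b′, all r′ - k + 1 vertices of the edge in [b′, n - 1 - b′] lie
  -- strictly inside [b, n - 1 - b], where there are at most r′ - k.
  level-≤ : ∀ {b b′ F F′ j j′} → Zoned b F → Zoned b′ F′ → j ≤ k → j′ ≤ k →
            (∀ {y} → Edge F′ j′ y → Edge F j y) → b′ ≤ b
  level-≤ {b} {b′} {F} {F′} {j} Z Z′ j≤k j′≤k sub = ≮⇒≥ absurd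
    where
    module Z  = Zoned Z
    module Z′ = Zoned Z′
    module _ (b<b′ : b < b′) where
      inner : ∀ {i} → k ≤ i → i ≤ r′ → b < F′ i × suc (F′ i + b) < n
      inner {i} k≤i i≤r′ with middle-bounds Z′ k≤i i≤r′
      ... | b′≤ , <n = <-≤-trans b<b′ b′≤
                     , ≤-<-trans (≤-trans (≤-reflexive (sym (+-suc _ b))) (+-monoʳ-≤ (F′ i) b<b′)) <n
      position : ∀ {i} → k ≤ i → i ≤ r′ → ∃ λ p → k ≤ p × p ≤ r′ × F p ≡ F′ i
      position k≤i i≤r′ with inner k≤i i≤r′
      ... | b<F , F<n = middle-index Z j≤k (sub (middle-edge j′≤k k≤i i≤r′)) (<⇒≤ b<F) (<⇒≤ F<n)
      -- Both sequences increase strictly, so if `F′ k` occurs in `F` at position `l` or later, then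
      -- `F′ (k + d)` occurs at `l + d` or later.
      positions-advance : ∀ l → (∀ {p} → k ≤ p → p ≤ r′ → F p ≡ F′ k → l ≤ p) →
                          ∀ d {p} → k + d ≤ r′ → k ≤ p → p ≤ r′ → F p ≡ F′ (k + d) → l + d ≤ p
      positions-advance l base zero {p} k≤r′ k≤p p≤r′ eq =
        ≤-trans (≤-reflexive (+-identityʳ l)) (base k≤p p≤r′ (trans eq (cong F′ (+-identityʳ k))))
      positions-advance l base (suc d) {p} k+≤r′ k≤p p≤r′ eq = subst (_≤ p) (sym (+-suc l d)) lt
        where
        k+d<r′ : k + d < r′
        k+d<r′ = subst (_≤ r′) (+-suc k d) k+≤r′
        lt : l + d < p
        lt with position (m≤m+n k d) (<⇒≤ k+d<r′)
        ... | q , k≤q , q≤r′ , eq′ =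
          ≤-<-trans (positions-advance l base d (<⇒≤ k+d<r′) k≤q q≤r′ eq′)
            (Z.cancel-< (≤-<-trans q≤r′ r′<s)
              (subst₂ _<_ (sym eq′) (sym eq)
                (Z′.mono (+-monoʳ-< k (n<1+n d)) (≤-<-trans k+≤r′ r′<s))))
      last : k + (r′ ∸ k) ≡ r′
      last = m+[n∸m]≡n Z.k≤r′
      absurd : ⊥
      absurd with position Z.k≤r′ ≤-refl | Z.end
      -- The left end is taken by `F k`, so `F′ k` sits at `suc k` or later and `F′ r′` is pushed
      -- beyond position `r′`.
      ... | q , k≤q , q≤r′ , eq | inj₁ Fk≡b = <⇒≱ (s≤s q≤r′)
        (subst (_≤ q) (cong suc last)
          (positions-advance (suc k) base (r′ ∸ k) (≤-reflexive last) k≤q q≤r′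
            (trans eq (cong F′ (sym last)))))
        where
        base : ∀ {p} → k ≤ p → p ≤ r′ → F p ≡ F′ k → k < p
        base k≤p p≤r′ eq′ = Z.cancel-< (≤-<-trans Z.k≤r′ r′<s)
          (subst₂ _<_ (sym Fk≡b) (sym eq′) (proj₁ (inner ≤-refl Z.k≤r′)))
      -- Here `F′ r′` is forced to position `r′`, so it equals the right end `F r′`, although
      -- `inner` puts it strictly before that end.
      ... | q , k≤q , q≤r′ , eq | inj₂ Fr′+b≡ = <-irrefl (trans (cong (λ x → suc (x + b)) F′r′≡) Fr′+b≡)
                                                  (proj₂ (inner Z.k≤r′ ≤-refl))
        where
        r′≤q : r′ ≤ q
        r′≤q = subst (_≤ q) last
          (positions-advance k (λ k≤p _ _ → k≤p) (r′ ∸ k) (≤-reflexive last) k≤q q≤r′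
            (trans eq (cong F′ (sym last))))
        F′r′≡ : F′ r′ ≡ F r′
        F′r′≡ = trans (sym eq) (cong F (≤-antisym q≤r′ r′≤q))

  -- At a common level, `F′ k` lies in the interval and on the edge of `F`, so it is some `F i` with
  -- `k ≤ i`. Used in both directions, this shows that the edge fixes the first vertex in the
  -- interval.
  first-≤ : ∀ {b F F′ j j′} → Zoned b F → Zoned b F′ → j ≤ k → j′ ≤ k →
            (∀ {y} → Edge F′ j′ y → Edge F j y) → F k ≤ F′ k
  first-≤ {F = F} Z Z′ j≤k j′≤k sub with middle-bounds Z′ ≤-refl (Zoned.k≤r′ Z)
  ... | b≤ , <n with middle-index Z j≤k (sub (middle-edge j′≤k ≤-refl (Zoned.k≤r′ Z))) b≤ <n
  ...   | i , k≤i , i≤r′ , eq = subst (F k ≤_) eq (Zoned.mono-≤ Z k≤i (≤-<-trans i≤r′ r′<s))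

  last-≤ : ∀ {b F F′ j j′} → Zoned b F → Zoned b F′ → j ≤ k → j′ ≤ k →
           (∀ {y} → Edge F′ j′ y → Edge F j y) → F′ r′ ≤ F r′
  last-≤ {F = F} Z Z′ j≤k j′≤k sub with middle-bounds Z′ (Zoned.k≤r′ Z) ≤-refl
  ... | b≤ , <n with middle-index Z j≤k (sub (middle-edge j′≤k (Zoned.k≤r′ Z) ≤-refl)) b≤ <n
  ...   | i , k≤i , i≤r′ , eq = subst (_≤ F r′) eq (Zoned.mono-≤ Z i≤r′ r′<s)

  -- Mirror images of paths.

  -- Reflecting vertices alone would make the sequence decrease, so positions are reflected too.
  mirror : (ℕ → ℕ) → ℕ → ℕ
  mirror F i = rev n (F (rev s i))

  rev-s-k : rev s k ≡ r′
  rev-s-k = m+n∸n≡m r′ k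

  rev-s-r′ : rev s r′ ≡ k
  rev-s-r′ = m+n∸m≡n r′ k

  -- The interval [b, n - 1 - b] and the block of positions from `k` to `r′` are symmetric, so `b`
  -- is kept while `low` and `high`, and the two cases of `end`, change places.
  mirror-zoned : ∀ {b F} → Zoned b F → Zoned b (mirror F)
  mirror-zoned {b} {F} Z = record
    { mono  = λ i<j j<s → rev-anti-< (mono (rev-anti-< i<j j<s) (rev-< (<-trans i<j j<s)))
                                     (bound (rev-< (<-trans i<j j<s)))
    ; bound = λ i<s → rev-< (bound (rev-< i<s))
    ; k≤r′  = k≤r′
    ; low   = λ {i} i<k →
        let i<s = <-≤-trans i<k (m≤n+m k r)
            y<n = bound (rev-< i<s)
            y   = F (rev s i)
        in +-cancelʳ-≤ y _ b (begin
             suc (rev n y) + y  ≡⟨ sym (+-suc (rev n y) y) ⟩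
             rev n y + suc y    ≡⟨ rev-+ y<n ⟩
             n                  ≤⟨ high (subst (_≤ rev s i) (m+n∸n≡m r k) (∸-monoʳ-≤ s i<k)) (rev-< i<s) ⟩
             y + b              ≡⟨ +-comm y b ⟩
             b + y              ∎)
    ; b≤Fk  = subst (λ i → b ≤ rev n (F i)) (sym rev-s-k)
        (m+n≤o⇒m≤o∸n b (subst (_≤ n) (trans (cong suc (+-comm (F r′) b)) (sym (+-suc b (F r′)))) Fr′+b<n))
    ; Fr′+b<n = subst (λ i → rev n (F i) + b < n) (sym rev-s-r′)
        (≤-trans (+-monoʳ-< (rev n (F k)) (s≤s b≤Fk)) (≤-reflexive (rev-+ Fk<n)))
    ; high  = λ {i} r≤i i<s →
        let y   = F (rev s i)
            i*<k : rev s i < k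
            i*<k = subst (rev s i <_) rev-s-r′ (rev-anti-< r≤i i<s)
        in ≤-trans (≤-reflexive (sym (rev-+ (bound (rev-< i<s))))) (+-monoʳ-≤ (rev n y) (low i*<k))
    ; end   = mirror-end end
    }
    where
    open Zoned Z
    open ≤-Reasoning
    Fk<n : F k < n
    Fk<n = bound (≤-<-trans k≤r′ r′<s)
    mirror-end : F k ≡ b ⊎ suc (F r′ + b) ≡ n → mirror F k ≡ b ⊎ suc (mirror F r′ + b) ≡ n
    mirror-end (inj₁ Fk≡b) = inj₂ (trans (cong (λ i → suc (rev n (F i) + b)) rev-s-r′)
      (trans (cong (λ c → suc (rev n (F k) + c)) (sym Fk≡b))
        (trans (sym (+-suc _ (F k))) (rev-+ Fk<n))))
    mirror-end (inj₂ eq) = inj₁ (trans (cong (rev n ∘ F) rev-s-k)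
      (trans (cong (_∸ suc (F r′)) (sym eq)) (m+n∸m≡n (suc (F r′)) b)))

  -- The last position `j + r′` of an edge reflects to `k ∸ j`, which becomes the start.
  rev-range : ∀ {i j} → j ≤ k → j ≤ i → i < j + r → k ∸ j ≤ rev s i × rev s i < (k ∸ j) + r
  rev-range {i} {j} j≤k j≤i i<j+r = lower , upper
    where
    open ≤-Reasoning
    i<s : i < s
    i<s = index<s j≤k i<j+r
    lower : k ∸ j ≤ rev s i
    lower = m+n≤o⇒m≤o∸n (k ∸ j) (begin
      (k ∸ j) + suc i    ≤⟨ +-monoʳ-≤ (k ∸ j) i<j+r ⟩
      (k ∸ j) + (j + r)  ≡⟨ sym (+-assoc (k ∸ j) j r) ⟩
      (k ∸ j) + j + r    ≡⟨ cong (_+ r) (m∸n+n≡m j≤k) ⟩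
      k + r              ≡⟨ +-comm k r ⟩
      s                  ∎)
    upper : rev s i < (k ∸ j) + r
    upper = +-cancelʳ-≤ i _ _ (begin
      suc (rev s i) + i    ≡⟨ sym (+-suc (rev s i) i) ⟩
      rev s i + suc i      ≡⟨ rev-+ i<s ⟩
      r + k                ≡⟨ +-comm r k ⟩
      k + r                ≡⟨ cong (_+ r) (sym (m∸n+n≡m j≤k)) ⟩
      (k ∸ j) + j + r      ≡⟨ +-assoc (k ∸ j) j r ⟩
      (k ∸ j) + (j + r)    ≡⟨ cong ((k ∸ j) +_) (+-comm j r) ⟩
      (k ∸ j) + (r + j)    ≡⟨ sym (+-assoc (k ∸ j) r j) ⟩
      (k ∸ j) + r + j      ≤⟨ +-monoʳ-≤ ((k ∸ j) + r) j≤i ⟩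
      (k ∸ j) + r + i      ∎)

  mirror-edge⁺ : ∀ {F j y} → j ≤ k → Edge F (k ∸ j) y → Edge (mirror F) j (rev n y)
  mirror-edge⁺ {F} {j} j≤k (i , lo , hi , refl) =
    let lo′ , hi′ = rev-range (m∸n≤m k j) lo hi
        k∸[k∸j]≡j = m∸[m∸n]≡n j≤k
    in rev s i , subst (_≤ rev s i) k∸[k∸j]≡j lo′
               , subst (λ x → rev s i < x + r) k∸[k∸j]≡j hi′
               , cong (rev n ∘ F) (rev-rev (index<s (m∸n≤m k j) hi))

  mirror-edge⁻ : ∀ {b F j y} → Zoned b F → j ≤ k → Edge (mirror F) j y → Edge F (k ∸ j) (rev n y)
  mirror-edge⁻ Z j≤k (i , lo , hi , refl) =
    let lo′ , hi′ = rev-range j≤k lo hi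
    in rev s i , lo′ , hi′ , sym (rev-rev (Zoned.bound Z (rev-< (index<s j≤k hi))))

  mirror-⊆ : ∀ {b b′ F F′ j j′} → Zoned b F → Zoned b′ F′ → j ≤ k → j′ ≤ k →
             (∀ {y} → Edge (mirror F) j y → Edge (mirror F′) j′ y) →
             ∀ {y} → Edge F (k ∸ j) y → Edge F′ (k ∸ j′) y
  mirror-⊆ {F′ = F′} {j} {j′} Z Z′ j≤k j′≤k sub {y} e@(i , lo , hi , eq) =
    subst (Edge F′ (k ∸ j′)) (rev-rev y<n) (mirror-edge⁻ Z′ j′≤k (sub (mirror-edge⁺ j≤k e)))
    where
    y<n : y < n
    y<n = subst (_< n) eq (Zoned.bound Z (index<s (m∸n≤m k j) hi))

  -- The walk of a biased set.

  -- All that the walk needs from left-bias, for both sizes `r` and `r′` at once. `gap` puts every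
  -- element of `S` strictly below n - 1 - b, where b is `nth S k`.
  record Fits (S : Subset n) : Set where
    field
      k<∣S∣   : k < ∣ S ∣
      ∣S∣≤r   : ∣ S ∣ ≤ r
      r≤1+∣S∣ : r ≤ suc ∣ S ∣
      gap     : ∀ {i} → i < ∣ S ∣ → suc (nth S i + nth S k) < n

  walk : Subset n → ℕ → ℕ
  walk S i with i <? ∣ S ∣ | i <? r
  ... | yes _ | _     = nth S i
  ... | no  _ | yes _ = rev n (nth S k)
  ... | no  _ | no  _ = nth S (i ∸ r) + (n ∸ nth S k)

  data WalkView (S : Subset n) (i : ℕ) : ℕ → Set where
    start  : i < ∣ S ∣ → WalkView S i (nth S i)
    centre : ∣ S ∣ ≤ i → i < r → WalkView S i (rev n (nth S k))
    finish : ∣ S ∣ ≤ i → r ≤ i → WalkView S i (nth S (i ∸ r) + (n ∸ nth S k))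

  walk-view : ∀ S i → WalkView S i (walk S i)
  walk-view S i with i <? ∣ S ∣ | i <? r
  ... | yes i<  | _       = start i<
  ... | no  i≮S | yes i<r = centre (≮⇒≥ i≮S) i<r
  ... | no  i≮S | no  i≮r = finish (≮⇒≥ i≮S) (≮⇒≥ i≮r)

  walk-start : ∀ S {i} → i < ∣ S ∣ → walk S i ≡ nth S i
  walk-start S {i} i<S with walk S i | walk-view S i
  ... | _ | start _      = refl
  ... | _ | centre S≤i _ = contradiction i<S (≤⇒≯ S≤i)
  ... | _ | finish S≤i _ = contradiction i<S (≤⇒≯ S≤i)

  module Walk {S : Subset n} (fits : Fits S) where
    open Fits fits

    level : ℕ
    level = nth S k

    suc-level≤n : suc level ≤ n
    suc-level≤n = ≤-trans (s≤s (m≤n+m level level)) (<⇒≤ (gap k<∣S∣))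

    level≤n : level ≤ n
    level≤n = <⇒≤ suc-level≤n

    walk-finish : ∀ {l} → walk S (r + l) ≡ nth S l + (n ∸ level)
    walk-finish {l} with walk S (r + l) | walk-view S (r + l)
    ... | _ | start i<S    = contradiction i<S (≤⇒≯ (≤-trans ∣S∣≤r (m≤m+n r l)))
    ... | _ | centre _ i<r = contradiction i<r (≤⇒≯ (m≤m+n r l))
    ... | _ | finish _ _   = cong (λ x → nth S x + (n ∸ level)) (m+n∸m≡n r l)

    nth<rev : ∀ {i} → i < ∣ S ∣ → nth S i < rev n level
    nth<rev {i} i<S = m+n≤o⇒m≤o∸n (suc (nth S i))
      (subst (_≤ n) (cong suc (sym (+-suc (nth S i) level))) (gap i<S))

    rev<finish : ∀ y → rev n level < y + (n ∸ level)
    rev<finish y = <-≤-trans (∸-monoʳ-< (n<1+n level) suc-level≤n) (m≤n+m (n ∸ level) y)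

    finish-+ : ∀ y → y + (n ∸ level) + level ≡ y + n
    finish-+ y = trans (+-assoc y (n ∸ level) level) (cong (y +_) (m∸n+n≡m level≤n))

    walk-suc : ∀ i → walk S i < walk S (suc i)
    walk-suc i with walk S i | walk-view S i | walk S (suc i) | walk-view S (suc i)
    ... | _ | start _      | _ | start _      = nth-mono-< S (n<1+n i)
    ... | _ | start i<S    | _ | centre _ _   = nth<rev i<S
    ... | _ | start i<S    | _ | finish _ _   = <-trans (nth<rev i<S) (rev<finish _)
    ... | _ | centre S≤i _ | _ | start i<S    = contradiction (<-trans (n<1+n i) i<S) (≤⇒≯ S≤i)
    ... | _ | centre S≤i _ | _ | centre _ i<r = contradiction (≤-trans i<r (≤-trans r≤1+∣S∣ (s≤s S≤i))) (<-irrefl refl)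
    ... | _ | centre _ _   | _ | finish _ _   = rev<finish _
    ... | _ | finish S≤i _ | _ | start i<S    = contradiction (<-trans (n<1+n i) i<S) (≤⇒≯ S≤i)
    ... | _ | finish _ r≤i | _ | centre _ i<r = contradiction (<-trans (n<1+n i) i<r) (≤⇒≯ r≤i)
    ... | _ | finish _ r≤i | _ | finish _ _   =
      +-monoˡ-< (n ∸ level) (nth-mono-< S (∸-monoˡ-< (n<1+n i) r≤i))

    walk-mono : ∀ {i j} → i < j → walk S i < walk S j
    walk-mono {i} {suc j} (s≤s i≤j) with m≤n⇒m<n∨m≡n i≤j
    ... | inj₁ i<j  = <-trans (walk-mono i<j) (walk-suc j)
    ... | inj₂ refl = walk-suc j

    walk-high : ∀ {i} → r ≤ i → n ≤ walk S i + level
    walk-high {i} r≤i with walk S i | walk-view S i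
    ... | _ | start i<S    = contradiction (<-≤-trans i<S ∣S∣≤r) (≤⇒≯ r≤i)
    ... | _ | centre _ i<r = contradiction i<r (≤⇒≯ r≤i)
    ... | _ | finish _ _   = ≤-trans (m≤n+m n _) (≤-reflexive (sym (finish-+ _)))

    rev-level-+ : suc (rev n level + level) ≡ n
    rev-level-+ = trans (sym (+-suc _ level)) (rev-+ suc-level≤n)

    walk-not-high : ∀ {i} → i < r → walk S i + level < n
    walk-not-high {i} i<r with walk S i | walk-view S i
    ... | _ | start i<S    = <⇒≤ (gap i<S)
    ... | _ | centre _ _   = ≤-reflexive rev-level-+
    ... | _ | finish _ r≤i = contradiction i<r (≤⇒≯ r≤i)

    walk-bound : ∀ {i} → i < s → walk S i < n
    walk-bound {i} i<s with walk S i | walk-view S i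
    ... | _ | start i<S    = ≤-trans (s≤s (m≤m+n _ level)) (<⇒≤ (gap i<S))
    ... | _ | centre _ _   = rev-< suc-level≤n
    -- Since `i ∸ r < k`, only elements below `level` are translated, so adding `n ∸ level` keeps
    -- them below `n`.
    ... | _ | finish _ r≤i = <-≤-trans
      (+-monoˡ-< (n ∸ level) (nth-mono-< S {i ∸ r} {k}
        (subst (i ∸ r <_) (m+n∸m≡n r k) (∸-monoˡ-< i<s r≤i))))
      (≤-reflexive (m+[n∸m]≡n level≤n))

    walk-k : walk S k ≡ level
    walk-k = walk-start S k<∣S∣

    walk-zoned : Zoned level (walk S)
    walk-zoned = record
      { mono    = λ i<j _ → walk-mono i<j
      ; bound   = walk-bound
      ; k≤r′    = ≤-pred (<-≤-trans k<∣S∣ ∣S∣≤r)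
      ; low     = λ i<k → subst (walk S _ <_) walk-k (walk-mono i<k)
      ; b≤Fk    = ≤-reflexive (sym walk-k)
      ; Fr′+b<n = walk-not-high ≤-refl
      ; high    = λ r≤i _ → walk-high r≤i
      ; end     = inj₁ walk-k
      }

    -- Position `r′` tells the two sizes apart: for an `r`-set it is still an element of `S`, so
    -- `gap` keeps it off the right end; for an `r′`-set it is the inserted right end itself.
    walk-r′-full : ∣ S ∣ ≡ r → suc (walk S r′ + level) < n
    walk-r′-full ∣S∣≡r = subst (λ y → suc (y + level) < n) (sym (walk-start S r′<S)) (gap r′<S)
      where
      r′<S : r′ < ∣ S ∣
      r′<S = ≤-reflexive (sym ∣S∣≡r)

    walk-r′-deficient : ∣ S ∣ ≡ r′ → suc (walk S r′ + level) ≡ n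
    walk-r′-deficient refl with walk S r′ | walk-view S r′
    ... | _ | start i<S    = contradiction i<S (<-irrefl refl)
    ... | _ | centre _ _   = rev-level-+
    ... | _ | finish _ r≤i = contradiction r≤i (<-irrefl refl)

  -- Recovering the set from an edge.

  -- An element nth S i of S is missing from the edge starting at j only if
  -- i < j, and then its translate by n - level is in the edge.
  walk-decode : ∀ {S T j j′} → Fits S → Fits T → nth S k ≡ nth T k → j ≤ k → j′ ≤ k →
                (∀ {y} → Edge (walk S) j y → Edge (walk T) j′ y) →
                ∀ {i} → i < ∣ S ∣ → ∃ λ l → l < ∣ T ∣ × nth T l ≡ nth S i
  walk-decode {S} {T} {j} {j′} fS fT same j≤k j′≤k sub {i} i<S with j ≤? i
  ... | yes j≤i = low-case (sub (i , j≤i , ≤-trans i<S (≤-trans S.∣S∣≤r (m≤n+m r j)) , walk-start S i<S))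
    where
    module S = Fits fS
    module T = Walk fT
    -- By `gap` for `S`, this vertex is below n - 1 - b. The levels agree, so in the walk of `T` it
    -- is neither the centre nor a translate.
    low-case : Edge (walk T) j′ (nth S i) → ∃ λ l → l < ∣ T ∣ × nth T l ≡ nth S i
    low-case (l , _ , _ , eq) with walk T l | walk-view T l
    ... | _ | start l<T    = l , l<T , eq
    ... | _ | centre _ _   = contradiction
      (trans (cong₂ (λ x y → suc (x + y)) (sym eq) same) T.rev-level-+) (<⇒≢ (S.gap i<S))
    ... | _ | finish _ _   = contradiction
      (≤-trans (m≤n+m n _) (≤-trans (≤-reflexive (sym (T.finish-+ _)))
        (≤-reflexive (cong₂ _+_ eq (sym same))))) (<⇒≱ (<⇒≤ (S.gap i<S)))
  ... | no j≰i = high-case (sub (r + i , ≤-trans j≤k (≤-trans k≤r (m≤m+n r i)) , r+i<j+r , S.walk-finish))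
    where
    module S = Walk fS
    module T = Walk fT
    k≤r : k ≤ r
    k≤r = ≤-trans (<⇒≤ (Fits.k<∣S∣ fS)) (Fits.∣S∣≤r fS)
    r+i<j+r : r + i < j + r
    r+i<j+r = subst (r + i <_) (+-comm r j) (+-monoʳ-< r (≰⇒> j≰i))
    -- A translate is at least n - b, so in the walk of `T` it occupies a position from `r` on; the
    -- common shift then cancels.
    high-case : Edge (walk T) j′ (nth S i + (n ∸ nth S k)) → ∃ λ l → l < ∣ T ∣ × nth T l ≡ nth S i
    high-case (l , _ , l<j′+r , eq) with <-≤-connex l r
    ... | inj₁ l<r = contradiction (T.walk-not-high l<r)
      (≤⇒≯ (≤-trans (m≤n+m n (nth S i)) (≤-reflexive (sym (trans (cong₂ _+_ eq (sym same)) (S.finish-+ _))))))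
    ... | inj₂ r≤l = l ∸ r , <-trans l∸r<k (Fits.k<∣S∣ fT)
                  , +-cancelʳ-≡ (n ∸ nth T k) _ _
                      (trans (sym T.walk-finish)
                        (trans (cong (walk T) (m+[n∸m]≡n r≤l))
                          (trans eq (cong (λ c → nth S i + (n ∸ c)) same))))
      where
      l∸r<k : l ∸ r < k
      l∸r<k = subst (l ∸ r <_) (m+n∸m≡n r k) (∸-monoˡ-< (index<s j′≤k l<j′+r) r≤l)

  -- The three families and their separation.

  -- The names say which ends of [b, n - 1 - b] the paths hit. `left` and `right` both use the
  -- `r`-sets, `right` with mirrored walks.
  data Kind : Set where
    left right both : Kind

  size : Kind → ℕ
  size left  = r
  size right = r
  size both  = r′

  Code : Set
  Code = Kind × Subset n

  Biased : ℕ → Subset n → Set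
  Biased t S = ∣ S ∣ ≡ t × LeftBiased (suc k) S

  Valid : Code → Set
  Valid (κ , S) = Biased (size κ) S

  size≤r : ∀ κ → size κ ≤ r
  size≤r left  = ≤-refl
  size≤r right = ≤-refl
  size≤r both  = n≤1+n r′

  r≤1+size : ∀ κ → r ≤ suc (size κ)
  r≤1+size left  = n≤1+n r
  r≤1+size right = n≤1+n r
  r≤1+size both  = ≤-refl

  -- The first interval, of size `a`, holds `suc k` elements of `S`, so `nth S k < a`. The last
  -- starts at `c` and misses `S`, so each `nth S i < c`. Equal sizes give `c + a ≡ n`, and adding
  -- the two bounds gives `gap`.
  fits : ∀ {κ S} → Valid (κ , S) → Fits S
  fits {κ} {S} (∣S∣≡ , cut a c a≤c c≤n , ∣X∣≡∣Z∣ , ∣X∩S∣≡ , ∣Z∩S∣≡0) = record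
    { k<∣S∣   = ≤-trans (≤-reflexive (sym ∣X∩S∣≡)) (∣p∩q∣≤∣q∣ (interval 0 a) S)
    ; ∣S∣≤r   = subst (_≤ r) (sym ∣S∣≡) (size≤r κ)
    ; r≤1+∣S∣ = subst (λ t → r ≤ suc t) (sym ∣S∣≡) (r≤1+size κ)
    ; gap     = λ {i} i<S → begin
        suc (suc (nth S i + nth S k))  ≡⟨ cong suc (sym (+-suc (nth S i) (nth S k))) ⟩
        suc (nth S i) + suc (nth S k)  ≤⟨ +-mono-≤ (below-Z i<S)
                                            (nth-<-interval a S (≤-reflexive (sym ∣X∩S∣≡))) ⟩
        c + a                          ≡⟨ cong (c +_) a≡n∸c ⟩
        c + (n ∸ c)                    ≡⟨ m+[n∸m]≡n c≤n ⟩
        n                              ∎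
    }
    where
    open ≤-Reasoning
    a≡n∸c : a ≡ n ∸ c
    a≡n∸c = trans (sym (∣interval∣ {n} 0 a (≤-trans a≤c c≤n))) (trans ∣X∣≡∣Z∣ (∣interval∣ {n} c n ≤-refl))
    below-Z : ∀ {i} → i < ∣ S ∣ → nth S i < c
    below-Z i<S with nth-∈ S i<S
    ... | y , y∈S , eq = subst (_< c) eq (≰⇒> λ c≤y →
      -- Removing `y` from the last part of `S` would lower its cardinality, which is already zero.
      n≮0 (≤-trans (x∈p⇒∣p-x∣<∣p∣ (x∈p∩q⁺ (∈-interval⁺ c n c≤y (toℕ<n y) , y∈S)))
                   (≤-reflexive ∣Z∩S∣≡0)))

  vertex : Code → ℕ → ℕ
  vertex (left  , S) = walk S
  vertex (right , S) = mirror (walk S)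
  vertex (both  , S) = walk S

  vertex-zoned : ∀ {κ S} → Valid (κ , S) → Zoned (nth S k) (vertex (κ , S))
  vertex-zoned {left}  v = Walk.walk-zoned (fits {left} v)
  vertex-zoned {right} v = mirror-zoned (Walk.walk-zoned (fits {right} v))
  vertex-zoned {both}  v = Walk.walk-zoned (fits {both} v)

  -- Which ends of [b, n - 1 - b] are hit, where x and y are the first and
  -- last vertex in this interval.
  Ends : Kind → ℕ → ℕ → ℕ → Set
  Ends left  b x y = x ≡ b × suc (y + b) < n
  Ends right b x y = b < x × suc (y + b) ≡ n
  Ends both  b x y = x ≡ b × suc (y + b) ≡ n

  ends-unique : ∀ κ κ′ {b x y} → Ends κ b x y → Ends κ′ b x y → κ ≡ κ′
  ends-unique left  left  _        _         = refl
  ends-unique right right _        _         = refl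
  ends-unique both  both  _        _         = refl
  ends-unique left  right (_ , lt) (_ , eq)  = contradiction eq (<⇒≢ lt)
  ends-unique left  both  (_ , lt) (_ , eq)  = contradiction eq (<⇒≢ lt)
  ends-unique right left  (_ , eq) (_ , lt)  = contradiction eq (<⇒≢ lt)
  ends-unique both  left  (_ , eq) (_ , lt)  = contradiction eq (<⇒≢ lt)
  ends-unique right both  (lt , _) (eq , _)  = contradiction (sym eq) (<⇒≢ lt)
  ends-unique both  right (eq , _) (lt , _)  = contradiction (sym eq) (<⇒≢ lt)

  vertex-ends : ∀ {κ S} → Valid (κ , S) → Ends κ (nth S k) (vertex (κ , S) k) (vertex (κ , S) r′)
  vertex-ends {left} v = walk-k , walk-r′-full (proj₁ v)
    where open Walk (fits {left} v)
  vertex-ends {both} v = walk-k , walk-r′-deficient (proj₁ v)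
    where open Walk (fits {both} v)
  -- Reflection swaps the ends: missing the right end becomes missing the left one, and hitting
  -- `level` at `k` becomes hitting the right end at `r′`.
  vertex-ends {right} {S} v =
      subst (λ i → level < rev n (walk S i)) (sym rev-s-k)
        (m+n≤o⇒m≤o∸n (suc level) (subst (_≤ n) reorder (walk-r′-full (proj₁ v))))
    , trans (cong (λ i → suc (rev n (walk S i) + level)) rev-s-r′)
        (trans (cong (λ y → suc (rev n y + level)) walk-k) rev-level-+)
    where
    open Walk (fits {right} v)
    reorder : suc (suc (walk S r′ + level)) ≡ suc level + suc (walk S r′)
    reorder = cong suc (trans (cong suc (+-comm (walk S r′) level)) (sym (+-suc level (walk S r′))))

  vertex-decode : ∀ κ {S T j j′} → Valid (κ , S) → Valid (κ , T) → nth S k ≡ nth T k → j ≤ k → j′ ≤ k →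
                  (∀ {y} → Edge (vertex (κ , S)) j y → Edge (vertex (κ , T)) j′ y) →
                  ∀ {y} → y ∈ S → y ∈ T
  vertex-decode left {S} {T} v w same j≤k j′≤k sub =
    nth-⊆ S T (walk-decode (fits {left} v) (fits {left} w) same j≤k j′≤k sub)
  vertex-decode both {S} {T} v w same j≤k j′≤k sub =
    nth-⊆ S T (walk-decode (fits {both} v) (fits {both} w) same j≤k j′≤k sub)
  vertex-decode right {S} {T} {j} {j′} v w same j≤k j′≤k sub =
    nth-⊆ S T (walk-decode fS fT same (m∸n≤m k j) (m∸n≤m k j′)
      (mirror-⊆ (Walk.walk-zoned fS) (Walk.walk-zoned fT) j≤k j′≤k sub))
    where
    fS : Fits S
    fS = fits {right} v
    fT : Fits T
    fT = fits {right} w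

  code-unique : ∀ {c d j j′} → Valid c → Valid d → j ≤ k → j′ ≤ k →
                (∀ {y} → Edge (vertex c) j y → Edge (vertex d) j′ y) →
                (∀ {y} → Edge (vertex d) j′ y → Edge (vertex c) j y) → c ≡ d
  code-unique {κ , S} {κ′ , T} {j} {j′} v w j≤k j′≤k sub sup = same-code same-kind w sub sup
    where
    F F′ : ℕ → ℕ
    F  = vertex (κ , S)
    F′ = vertex (κ′ , T)
    Z : Zoned (nth S k) F
    Z = vertex-zoned {κ} v
    Z₀ : Zoned (nth T k) F′
    Z₀ = vertex-zoned {κ′} w
    same : nth S k ≡ nth T k
    same = ≤-antisym (level-≤ Z₀ Z j′≤k j≤k sub) (level-≤ Z Z₀ j≤k j′≤k sup)
    Z′ : Zoned (nth S k) F′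
    Z′ = subst (λ b → Zoned b F′) (sym same) Z₀
    first≡ : F′ k ≡ F k
    first≡ = ≤-antisym (first-≤ Z′ Z j′≤k j≤k sub) (first-≤ Z Z′ j≤k j′≤k sup)
    last≡ : F′ r′ ≡ F r′
    last≡ = ≤-antisym (last-≤ Z Z′ j≤k j′≤k sup) (last-≤ Z′ Z j′≤k j≤k sub)
    same-kind : κ ≡ κ′
    same-kind = ends-unique κ κ′ (vertex-ends {κ} v)
      (subst₂ (Ends κ′ (nth S k)) first≡ last≡
        (subst (λ b → Ends κ′ b (F′ k) (F′ r′)) (sym same) (vertex-ends {κ′} w)))
    -- The second kind is quantified afresh so that it can be identified with `κ`; decoding then
    -- compares two sets of one family.
    same-code : ∀ {κ′} → κ ≡ κ′ → Valid (κ′ , T) →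
                (∀ {y} → Edge (vertex (κ , S)) j y → Edge (vertex (κ′ , T)) j′ y) →
                (∀ {y} → Edge (vertex (κ′ , T)) j′ y → Edge (vertex (κ , S)) j y) → (κ , S) ≡ (κ′ , T)
    same-code refl w sub sup = cong (κ ,_) (⊆-antisym
      (vertex-decode κ v w same j≤k j′≤k sub)
      (vertex-decode κ w v (sym same) j′≤k j≤k sup))

  -- From vertex sequences to copies of the path.

  module Embedding {b F} (Z : Zoned b F) where
    open Zoned Z

    embed : Fin s → Fin n
    embed i = fromℕ< (bound (toℕ<n i))

    toℕ-embed : ∀ i → toℕ (embed i) ≡ F (toℕ i)
    toℕ-embed i = toℕ-fromℕ< (bound (toℕ<n i))

    embed-mono : OrderEmbedding embed
    embed-mono i j i<j = subst₂ _<_ (sym (toℕ-embed i)) (sym (toℕ-embed j)) (mono i<j (toℕ<n j))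

    ∈-edge⁺ : ∀ {j y} → j ≤ k → Edge F j y → ∃ λ z → z ∈ image embed (interval j (j + r)) × toℕ z ≡ y
    ∈-edge⁺ {j} j≤k (i , j≤i , i<j+r , refl) =
        embed i′
      , ∈-image⁺ embed (∈-interval⁺ j (j + r) (subst (j ≤_) (sym i′≡i) j≤i) (subst (_< j + r) (sym i′≡i) i<j+r))
      , trans (toℕ-embed i′) (cong F i′≡i)
      where
      i<s : i < s
      i<s = index<s j≤k i<j+r
      i′ : Fin s
      i′ = fromℕ< i<s
      i′≡i : toℕ i′ ≡ i
      i′≡i = toℕ-fromℕ< i<s

    ∈-edge⁻ : ∀ {j y} → y ∈ image embed (interval j (j + r)) → Edge F j (toℕ y)
    ∈-edge⁻ {j} y∈ with ∈-image⁻ embed y∈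
    ... | i , i∈ , refl with ∈-interval⁻ j (j + r) i∈
    ...   | j≤i , i<j+r = toℕ i , j≤i , i<j+r , sym (toℕ-embed i)

  open Embedding

  edge-⊆ : ∀ {b b′ F F′ j j′} (Z : Zoned b F) (Z′ : Zoned b′ F′) → j ≤ k →
           image (embed Z) (interval j (j + r)) ≡ image (embed Z′) (interval j′ (j′ + r)) →
           ∀ {y} → Edge F j y → Edge F′ j′ y
  edge-⊆ {F′ = F′} {j′ = j′} Z Z′ j≤k eq e with ∈-edge⁺ Z j≤k e
  ... | z , z∈ , toℕz≡y = subst (Edge F′ j′) toℕz≡y (∈-edge⁻ Z′ (subst (z ∈_) eq z∈))

  #edges : suc s ∸ r ≡ suc k
  #edges = trans (cong (_∸ r′) (sym (+-suc r′ k))) (m+n∸m≡n r′ (suc k))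

  ∈-edgesOf⁻ : ∀ (f : Fin s → Fin n) {e} → e List.∈ edgesOf (copyUnder (path r s) f) →
               ∃ λ j → j ≤ k × e ≡ image f (interval j (j + r))
  ∈-edgesOf⁻ f e∈ with ∈-map⁻ (image f) e∈
  ... | _ , e′∈ , refl with ∈-map⁻ (λ j → interval j (j + r)) e′∈
  ...   | j , j∈ , refl = j , ≤-pred (subst (j <_) #edges (∈-upTo⁻ j∈)) , refl

  first-edge : ∀ (f : Fin s → Fin n) → image f (interval 0 r) List.∈ edgesOf (copyUnder (path r s) f)
  first-edge f = ∈-map⁺ (image f) (∈-map⁺ (λ j → interval j (j + r))
    (∈-upTo⁺ (subst (0 <_) (sym #edges) (s≤s z≤n))))

  -- The validity proof supplies the bounds for the embedding; copies are told apart below by their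
  -- codes alone.
  copy : ∃ Valid → SubHypergraph n
  copy ((κ , S) , v) = copyUnder (path r s) (embed (vertex-zoned {κ} {S} v))

  copy-isCopy : ∀ c → IsCopy (path r s) (copy c)
  copy-isCopy ((κ , S) , v) = embed Z , embed-mono Z , refl
    where
    Z : Zoned (nth S k) (vertex (κ , S))
    Z = vertex-zoned {κ} {S} v

  copy-disjoint : ∀ {c d} → proj₁ c ≢ proj₁ d → EdgeDisjoint (copy c) (copy d)
  copy-disjoint {(κ , S) , v} {(κ′ , T) , w} c≢d (e∈c , e∈d)
    with ∈-edgesOf⁻ (embed (vertex-zoned {κ} {S} v)) e∈c | ∈-edgesOf⁻ (embed (vertex-zoned {κ′} {T} w)) e∈d
  ... | j , j≤k , eq | j′ , j′≤k , eq′ =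
    c≢d (code-unique {κ , S} {κ′ , T} v w j≤k j′≤k
          (edge-⊆ Z Z′ j≤k (trans (sym eq) eq′)) (edge-⊆ Z′ Z j′≤k (trans (sym eq′) eq)))
    where
    Z : Zoned (nth S k) (vertex (κ , S))
    Z = vertex-zoned {κ} {S} v
    Z′ : Zoned (nth T k) (vertex (κ′ , T))
    Z′ = vertex-zoned {κ′} {T} w

  -- Equal copies would share their first edge, contradicting disjointness.
  copy-distinct : ∀ {c d} → proj₁ c ≢ proj₁ d → copy c ≢ copy d
  copy-distinct {c@((κ , S) , v)} {d} c≢d eq =
    copy-disjoint {c} {d} c≢d (e∈ , subst (λ x → _ List.∈ edgesOf x) eq e∈)
    where
    e∈ : image (embed (vertex-zoned {κ} {S} v)) (interval 0 r) List.∈ edgesOf (copy c)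
    e∈ = first-edge (embed (vertex-zoned {κ} {S} v))

  -- Counting the codes and assembling the packing.

  biased : ℕ → List (Subset n)
  biased t = filter (λ S → (∣ S ∣ ≟ t) ×-dec leftBiased? (suc k) S) (subsets n)

  codesOf : Kind → List Code
  codesOf κ = map (κ ,_) (biased (size κ))

  codes : List Code
  codes = codesOf left ++ codesOf right ++ codesOf both

  length-codes : length codes ≡ 2 * h n r (suc k) + h n r′ (suc k)
  length-codes = begin
    length codes
      ≡⟨ length-++ (codesOf left) ⟩
    length (codesOf left) + length (codesOf right ++ codesOf both)
      ≡⟨ cong (length (codesOf left) +_) (length-++ (codesOf right)) ⟩
    length (codesOf left) + (length (codesOf right) + length (codesOf both))
      ≡⟨ cong₂ _+_ (length-codesOf left) (cong₂ _+_ (length-codesOf right) (length-codesOf both)) ⟩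
    h n r (suc k) + (h n r (suc k) + h n r′ (suc k))
      ≡⟨ sym (+-assoc (h n r (suc k)) (h n r (suc k)) (h n r′ (suc k))) ⟩
    h n r (suc k) + h n r (suc k) + h n r′ (suc k)
      ≡⟨ cong (λ x → h n r (suc k) + x + h n r′ (suc k)) (sym (+-identityʳ (h n r (suc k)))) ⟩
    2 * h n r (suc k) + h n r′ (suc k)
      ∎
    where
    open ≡-Reasoning
    length-codesOf : ∀ κ → length (codesOf κ) ≡ h n (size κ) (suc k)
    length-codesOf κ = length-map (κ ,_) (biased (size κ))

  codes-valid : All Valid codes
  codes-valid = All.++⁺ (valid left) (All.++⁺ (valid right) (valid both))
    where
    valid : ∀ κ → All Valid (codesOf κ)
    valid κ = All.map⁺ (All.all-filter (λ S → (∣ S ∣ ≟ size κ) ×-dec leftBiased? (suc k) S) (subsets n))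

  codes-unique : Unique codes
  codes-unique = Unique.++⁺ (unique left)
    (Unique.++⁺ (unique right) (unique both)
      λ (c∈r , c∈b) → right≢both (trans (sym (kind-of right c∈r)) (kind-of both c∈b)))
    λ (c∈l , c∈rb) → left∉ c∈l (∈-++⁻ (codesOf right) c∈rb)
    where
    unique : ∀ κ → Unique (codesOf κ)
    unique κ = Unique.map⁺ (cong proj₂)
      (Unique.filter⁺ (λ S → (∣ S ∣ ≟ size κ) ×-dec leftBiased? (suc k) S) (subsets-unique n))
    kind-of : ∀ κ {c} → c List.∈ codesOf κ → proj₁ c ≡ κ
    kind-of κ c∈ with ∈-map⁻ (κ ,_) c∈
    ... | _ , _ , refl = refl
    right≢both : right ≢ both
    right≢both ()
    left∉ : ∀ {c} → c List.∈ codesOf left → c List.∈ codesOf right ⊎ c List.∈ codesOf both → ⊥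
    left∉ c∈l (inj₁ c∈r) with trans (sym (kind-of left c∈l)) (kind-of right c∈r)
    ... | ()
    left∉ c∈l (inj₂ c∈b) with trans (sym (kind-of left c∈l)) (kind-of both c∈b)
    ... | ()

  packing : HasPacking n (path r s) (2 * h n r (suc k) + h n r′ (suc k))
  packing = map copy valid-codes
    , record
        { copies   = All.map⁺ (All.universal copy-isCopy valid-codes)
        ; distinct = AllPairs.map⁺ (AllPairs.map (λ {c} {d} → copy-distinct {c} {d}) codes-differ)
        ; disjoint = AllPairs.map⁺ (AllPairs.map (λ {c} {d} → copy-disjoint {c} {d}) codes-differ)
        }
    , (begin
        length (map copy valid-codes)       ≡⟨ length-map copy valid-codes ⟩
        length valid-codes                  ≡⟨ sym (length-map proj₁ valid-codes) ⟩
        length (map proj₁ valid-codes)      ≡⟨ cong length (map-proj₁-toList codes-valid) ⟩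
        length codes                        ≡⟨ length-codes ⟩
        2 * h n r (suc k) + h n r′ (suc k)  ∎)
    where
    open ≡-Reasoning
    valid-codes : List (∃ Valid)
    valid-codes = All.toList codes-valid
    codes-differ : AllPairs (λ c d → proj₁ c ≢ proj₁ d) valid-codes
    codes-differ = AllPairs.map⁻ (subst Unique (sym (map-proj₁-toList codes-valid)) codes-unique)

theorem2p2 : ∀ (n r s m : ℕ) → 2 ∣ n → 1 ≤ r → r ≤ s → s ≤ 2 * r ∸ 1 → m ≡ s ∸ r + 1
    → ν n (path r s) ≥ 2 * h n r m + h n (r ∸ 1) m
theorem2p2 n (suc r′) s m _ _ r≤s _ m≡ =
  -- Take `k = s ∸ r`, so that `r + k` is `s` and `suc k` is `m`; the maximality of `ν` turns the
  -- packing into the bound.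
  subst₂ (λ s m → ν n (path (suc r′) s) ≥ 2 * h n (suc r′) m + h n r′ m)
    (m+[n∸m]≡n r≤s) (trans (+-comm 1 _) (sym m≡))
    (proj₂ (proj₂ (packingNumber n (path (suc r′) (suc r′ + (s ∸ suc r′))))) _
      (Paths.packing n r′ (s ∸ suc r′)))
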